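{- The set of all blossoms $\mathcal{B}_{b,t}$ in $G$ forms a laminar family: any two blossoms are either disjoint or one is contained in the other.
   Context: $G=(V,E)$ is a finite undirected graph with a matching $M$, with at least one unmatched vertex. Alternating paths are simple paths alternating between unmatched edges (not in $M$) and matched edges (in $M$), starting with an unmatched edge when starting at an unmatched vertex. $l_m$ is the minimum length of an augmenting path (alternating path between two distinct unmatched vertices), $\infty$ if none. $\mathrm{evenlevel}(v)$, $\mathrm{oddlevel}(v)$ are the minimum lengths of even, resp. odd, alternating paths from an unmatched vertex to $v$ ($\infty$ if none); such minimum paths are $\mathrm{evenlevel}(v)$, $\mathrm{oddlevel}(v)$ paths. Tenacity $t(v)=\mathrm{evenlevel}(v)+\mathrm{oddlevel}(v)$. A vertex is outer if $\mathrm{evenlevel}(v)<\mathrm{oddlevel}(v)$. For $t(v)=t<l_m$, $\mathrm{base}(v)$ is the vertex of tenacity $>t$ furthest from the starting unmatched vertex along any $\mathrm{evenlevel}(v)$ or $\mathrm{oddlevel}(v)$ path (known to be independent of the path). Blossoms: for an outer vertex $b$ and an odd number $t$ with $t<t(b)$ and $t<l_m$, $\mathcal{B}_{b,1}=\emptyset$, and for $t\ge3$, with $S_{b,t}=\{v: t(v)=t,\ \mathrm{base}(v)=b\}$, $\mathcal{B}_{b,t}=S_{b,t}\cup\bigcup_{v\in S_{b,t}\cup\{b\},\ v\text{ outer}}\mathcal{B}_{v,t-2}$. -}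

module Defs where

open import Data.Nat using (ℕ; zero; suc; _+_; _<_; _≤_)
open import Data.Fin using (Fin; zero; suc; toℕ; fromℕ; inject₁)
open import Data.Bool using (Bool; true; false; not)
open import Data.Product using (Σ; ∃; _×_; _,_; ∃-syntax)
open import Data.Sum using (_⊎_)
open import Relation.Binary.PropositionalEquality using (_≡_; _≢_)
open import Relation.Nullary using (¬_)
open import Function.Definitions using (Injective)

oddᵇ : ℕ → Bool
oddᵇ zero    = false
oddᵇ (suc k) = not (oddᵇ k)

Odd : ℕ → Set
Odd k = oddᵇ k ≡ true

Even : ℕ → Set
Even k = oddᵇ k ≡ false

record IsGraph {n : ℕ} (E : Fin n → Fin n → Bool) : Set where
  field
    symmetric   : ∀ u v → E u v ≡ E v u
    irreflexive : ∀ u → E u u ≡ false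

record IsMatching {n : ℕ} (E M : Fin n → Fin n → Bool) : Set where
  field
    sub        : ∀ u v → M u v ≡ true → E u v ≡ true
    symmetric  : ∀ u v → M u v ≡ M v u
    functional : ∀ u v w → M u v ≡ true → M u w ≡ true → v ≡ w

module _ {n : ℕ} (E M : Fin n → Fin n → Bool) where

  Unmatched : Fin n → Set
  Unmatched u = ∀ w → M u w ≡ false

  record AltPath (k : ℕ) (p : Fin (suc k) → Fin n) : Set where
    field
      start-unmatched : Unmatched (p zero)
      simple          : Injective _≡_ _≡_ p
      edge            : ∀ (i : Fin k) → E (p (inject₁ i)) (p (suc i)) ≡ true
      alternates      : ∀ (i : Fin k) → M (p (inject₁ i)) (p (suc i)) ≡ oddᵇ (toℕ i)

  AltPathTo : Fin n → ℕ → Set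
  AltPathTo v k = Σ (Fin (suc k) → Fin n) λ p → AltPath k p × p (fromℕ k) ≡ v

  -- evenlevel(v) = k  (evenlevel(v) = ∞ iff there is no such k)
  IsEvenLevel : Fin n → ℕ → Set
  IsEvenLevel v k = Even k × AltPathTo v k × (∀ k′ → Even k′ → AltPathTo v k′ → k ≤ k′)

  -- oddlevel(v) = k  (oddlevel(v) = ∞ iff there is no such k)
  IsOddLevel : Fin n → ℕ → Set
  IsOddLevel v k = Odd k × AltPathTo v k × (∀ k′ → Odd k′ → AltPathTo v k′ → k ≤ k′)

  TenacityEq : Fin n → ℕ → Set
  TenacityEq v t = ∃[ a ] ∃[ b ] (IsEvenLevel v a × IsOddLevel v b × a + b ≡ t)

  -- t(v) > t  (includes the case t(v) = ∞)
  TenacityGt : Fin n → ℕ → Set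
  TenacityGt v t = ∀ a b → IsEvenLevel v a → IsOddLevel v b → t < a + b

  -- v is outer: evenlevel(v) < oddlevel(v)  (oddlevel(v) may be ∞)
  Outer : Fin n → Set
  Outer v = ∃[ a ] (IsEvenLevel v a × (∀ b → IsOddLevel v b → a < b))

  BelowLm : ℕ → Set
  BelowLm t = ∀ k (p : Fin (suc k) → Fin n) → AltPath k p →
              Unmatched (p (fromℕ k)) → p zero ≢ p (fromℕ k) → t < k

  -- base(v) = b (for t(v) = t): along some evenlevel(v) or oddlevel(v)
  -- path p, b is the vertex of tenacity > t furthest from the start.
  IsBase : Fin n → ℕ → Fin n → Set
  IsBase v t b =
    ∃[ k ] Σ (Fin (suc k) → Fin n) λ p →
      AltPath k p × p (fromℕ k) ≡ v × (IsEvenLevel v k ⊎ IsOddLevel v k) ×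
      (∃[ i ] (p i ≡ b × TenacityGt b t ×
               (∀ j → toℕ i < toℕ j → ¬ TenacityGt (p j) t)))

  InS : Fin n → ℕ → Fin n → Set
  InS b t v = TenacityEq v t × IsBase v t b

  -- InBlossom b t w : w ∈ 𝓑_{b,t}.  𝓑_{b,1} = ∅ (no constructor for t = 1);
  -- for t = 3 + s ≥ 3:
  -- 𝓑_{b,t} = S_{b,t} ∪ ⋃_{v ∈ S_{b,t} ∪ {b}, v outer} 𝓑_{v,t-2}.
  data InBlossom : Fin n → ℕ → Fin n → Set where
    inS  : ∀ {b s w} → InS b (3 + s) w → InBlossom b (3 + s) w
    viaS : ∀ {b s v w} → InS b (3 + s) v → Outer v →
           InBlossom v (1 + s) w → InBlossom b (3 + s) w
    viaB : ∀ {b s w} → Outer b → InBlossom b (1 + s) w → InBlossom b (3 + s) w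

  IsBlossom : Fin n → ℕ → Set
  IsBlossom b t = Outer b × Odd t × TenacityGt b t × BelowLm t

{-# OPTIONS --safe #-}
module Submission where

-- The heart of the matter is that base(v) does not depend on the chosen path.
-- Give an unmatched edge uv the tenacity evenlevel(u) + evenlevel(v) + 1 and a
-- matched edge that of its ends.  Splicing a second path into a shortest one at
-- their first common vertex (forwards or backwards, according to parity) shows:
--  * on a shortest path to x, a vertex of tenacity ≥ t(x) is reached by a
--    shortest path itself;
--  * after the last vertex b of tenacity ≥ T, a shortest path only uses edges of
--    tenacity < T, so x and b are connected by such edges.
-- By induction on T, the edges of tenacity < T never connect two distinct
-- vertices of tenacity ≥ T (T ≤ l_m).  For the step one compares the last such
-- vertices on an even and an odd shortest path of one vertex, and on the shortest
-- even paths to the two ends of an edge.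
-- Hence the bases are unique, the blossoms containing w are read off the chain
-- w, base(w), base(base(w)), …, and two blossoms sharing w are nested.

open import Defs
open import Data.Nat using (ℕ; zero; suc; _+_; _≤_; _<_; z≤n; s≤s; s≤s⁻¹; _≤?_)
open import Data.Nat.Properties
open import Data.Nat.Induction using (<-rec)
open import Data.Fin using (Fin; zero; suc; toℕ; fromℕ; fromℕ<; inject₁)
open import Data.Fin.Relation.Unary.Top using (view; ‵fromℕ; ‵inject₁)
import Data.Fin.Properties as Fin
open import Data.Bool using (Bool; true; false; not)
import Data.Bool.Properties as Bool
open import Data.Product using (Σ; ∃; _×_; _,_; proj₁; proj₂; ∃-syntax)
open import Data.Sum using (_⊎_; inj₁; inj₂; [_,_]′)
open import Data.Empty using (⊥; ⊥-elim)
open import Data.List using (List; []; _∷_)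
open import Data.List.Relation.Unary.All as All using (All; []; _∷_)
open import Relation.Nullary using (¬_; Dec; yes; no)
open import Relation.Nullary.Decidable using (map′; _×-dec_; _⊎-dec_; ¬?)
open import Relation.Binary.Construct.Closure.ReflexiveTransitive using (Star; ε; _◅_)
open import Relation.Binary.PropositionalEquality
open import Function using (_∘_)

-- Booleans and parity.

flip-not : ∀ {x y} → x ≡ not y → y ≡ not x
flip-not {y = y} refl = sym (Bool.not-involutive y)

same-or-opp : ∀ x y → x ≡ y ⊎ x ≡ not y
same-or-opp false false = inj₁ refl
same-or-opp false true  = inj₂ refl
same-or-opp true  false = inj₂ refl
same-or-opp true  true  = inj₁ refl

x≢not-x : ∀ {x} → x ≢ not x
x≢not-x {false} ()
x≢not-x {true}  ()

false≢true : ∀ {x} → x ≡ false → x ≢ true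
false≢true refl ()

even-or-odd : ∀ k → Even k ⊎ Odd k
even-or-odd k = same-or-opp (oddᵇ k) false

not-not-elim : ∀ {x y} → not (not x) ≡ y → x ≡ y
not-not-elim {x} eq = trans (sym (Bool.not-involutive x)) eq

-- The one other candidate, `s = 1 + t`, has the parity opposite to `2 + t`.
odd-< : ∀ {s t} → Odd s → Odd (2 + t) → s < 2 + t → s ≤ t
odd-< {s} {t} os ot s<2+t with m≤n⇒m<n∨m≡n (s≤s⁻¹ s<2+t)
... | inj₁ s<1+t = s≤s⁻¹ s<1+t
... | inj₂ refl  = ⊥-elim (x≢not-x (trans os (sym ot)))

module Alternating {n : ℕ} {E M : Fin n → Fin n → Bool}
                   (graph : IsGraph E) (matching : IsMatching E M) where

  E-sym : ∀ {u v} → E u v ≡ true → E v u ≡ true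
  E-sym {u} {v} e = trans (IsGraph.symmetric graph v u) e

  M-sym : ∀ {u v b} → M u v ≡ b → M v u ≡ b
  M-sym {u} {v} e = trans (IsMatching.symmetric matching v u) e

  mate-unique : ∀ {u u′ v} → M u v ≡ true → M u′ v ≡ true → u ≡ u′
  mate-unique m m′ = IsMatching.functional matching _ _ _ (M-sym m) (M-sym m′)

  -- Alternating paths, their prefixes and segments.

  mutual
    -- Paths grow at their end, so the length fixes whether the next edge is matched, and a prefix
    -- is a subterm.
    data Path : ℕ → Fin n → Set where
      start : ∀ {f} → Unmatched E M f → Path 0 f
      step  : ∀ {k u v} (P : Path k u) → E u v ≡ true → M u v ≡ oddᵇ k →
              ¬ v ∈ P → Path (suc k) v

    _∈_ : ∀ {k u} → Fin n → Path k u → Set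
    y ∈ start {f} _            = y ≡ f
    y ∈ step {v = v} P _ _ _   = y ≡ v ⊎ y ∈ P

  data _⊑_ {j w} (Q : Path j w) : ∀ {k x} → Path k x → Set where
    here  : Q ⊑ Q
    there : ∀ {k u v} {P : Path k u} {e m s} → Q ⊑ P → Q ⊑ step {v = v} P e m s

  private variable
    i j k k′ l m t T : ℕ
    a b c u v w x y z : Fin n

  -- A derivation of `Q ⊑ P` doubles as the segment of `P` behind `Q`: `After` leaves out the end of
  -- `Q`, `On` includes it.
  After : {Q : Path j w} {P : Path k x} → Q ⊑ P → Fin n → Set
  After here              y = ⊥
  After (there {v = v} S) y = y ≡ v ⊎ After S y

  On : {Q : Path j w} {P : Path k x} → Q ⊑ P → Fin n → Set
  On {w = w} S y = y ≡ w ⊎ After S y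

  end-∈ : (P : Path k x) → x ∈ P
  end-∈ (start _)      = refl
  end-∈ (step _ _ _ _) = inj₁ refl

  ⊑-length : {Q : Path j w} {P : Path k x} → Q ⊑ P → j ≤ k
  ⊑-length here      = ≤-refl
  ⊑-length (there S) = m≤n⇒m≤1+n (⊑-length S)

  ⊑-trans : {O : Path i v} {Q : Path j w} {P : Path k x} → O ⊑ Q → Q ⊑ P → O ⊑ P
  ⊑-trans S here       = S
  ⊑-trans S (there S′) = there (⊑-trans S S′)

  ∈-⊑ : {Q : Path j w} {P : Path k x} → Q ⊑ P → y ∈ Q → y ∈ P
  ∈-⊑ here      p = p
  ∈-⊑ (there S) p = inj₂ (∈-⊑ S p)

  end-∈-⊑ : {Q : Path j w} {P : Path k x} → Q ⊑ P → w ∈ P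
  end-∈-⊑ {Q = Q} S = ∈-⊑ S (end-∈ Q)

  After-∈ : {Q : Path j w} {P : Path k x} (S : Q ⊑ P) → After S y → y ∈ P
  After-∈ (there S) (inj₁ p) = inj₁ p
  After-∈ (there S) (inj₂ p) = inj₂ (After-∈ S p)

  On-∈ : {Q : Path j w} {P : Path k x} (S : Q ⊑ P) → On S y → y ∈ P
  On-∈ S (inj₁ refl) = end-∈-⊑ S
  On-∈ S (inj₂ p)    = After-∈ S p

  On-end : {Q : Path j w} {P : Path k x} (S : Q ⊑ P) → On S x
  On-end here      = inj₁ refl
  On-end (there S) = inj₂ (inj₁ refl)

  On-there : {Q : Path j w} {P : Path k x} (S : Q ⊑ P) →
             On S y → y ≡ w ⊎ y ≡ v ⊎ After S y
  On-there S (inj₁ p) = inj₁ p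
  On-there S (inj₂ p) = inj₂ (inj₂ p)

  After-∉ : {Q : Path j w} {P : Path k x} (S : Q ⊑ P) → After S y → ¬ y ∈ Q
  After-∉ (there {s = s} S) (inj₁ refl) q = s (∈-⊑ S q)
  After-∉ (there S) (inj₂ p) q = After-∉ S p q

  ∈-After : {Q : Path j w} {P : Path k x} (S : Q ⊑ P) → y ∈ P → ¬ y ∈ Q → After S y
  ∈-After here      p        q = ⊥-elim (q p)
  ∈-After (there S) (inj₁ p) q = inj₁ p
  ∈-After (there S) (inj₂ p) q = inj₂ (∈-After S p q)

  After-trans⁻ : {O : Path i v} {Q : Path j w} {P : Path k x} (S : O ⊑ Q) (S′ : Q ⊑ P) →
                 After (⊑-trans S S′) y → After S y ⊎ After S′ y
  After-trans⁻ S here       p        = inj₁ p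
  After-trans⁻ S (there S′) (inj₁ p) = inj₂ (inj₁ p)
  After-trans⁻ S (there S′) (inj₂ p) with After-trans⁻ S S′ p
  ... | inj₁ q = inj₁ q
  ... | inj₂ q = inj₂ (inj₂ q)

  After-transʳ : {O : Path i v} {Q : Path j w} {P : Path k x} (S : O ⊑ Q) (S′ : Q ⊑ P) →
                 After S′ y → After (⊑-trans S S′) y
  After-transʳ S (there S′) (inj₁ p) = inj₁ p
  After-transʳ S (there S′) (inj₂ p) = inj₂ (After-transʳ S S′ p)

  On-unstep : {Q : Path j w} {P : Path k x} {e : E w v ≡ true} {m : M w v ≡ oddᵇ j}
              {s : ¬ v ∈ Q} (S : step Q e m s ⊑ P) →
              On S y → On (⊑-trans (there here) S) y
  On-unstep {s = s} S (inj₁ refl) =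
    inj₂ (∈-After (⊑-trans (there here) S) (end-∈-⊑ S) s)
  On-unstep S (inj₂ p)    = inj₂ (After-transʳ (there here) S p)

  ⊑-compare : {Q : Path j w} {Q′ : Path l y} {P : Path k x} →
              Q ⊑ P → Q′ ⊑ P → j ≤ l → Q ⊑ Q′
  ⊑-compare S         here       _ = S
  ⊑-compare here      (there S′) p = ⊥-elim (<⇒≱ p (⊑-length S′))
  ⊑-compare (there S) (there S′) p = ⊑-compare S S′ p

  ⊑-same-end : {Q : Path j x} {P : Path k x} → Q ⊑ P → j ≡ k
  ⊑-same-end here              = refl
  ⊑-same-end (there {s = s} S) = ⊥-elim (s (end-∈-⊑ S))

  ⊑-shorter : {Q : Path j w} {P : Path k x} → Q ⊑ P → w ≢ x → j < k
  ⊑-shorter here      w≢x = ⊥-elim (w≢x refl)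
  ⊑-shorter (there S) _   = s≤s (⊑-length S)

  ∈-prefix : (P : Path k x) → y ∈ P → ∃[ j ] Σ (Path j y) λ Q → Q ⊑ P
  ∈-prefix P@(start _)      refl        = _ , P , here
  ∈-prefix P@(step _ _ _ _) (inj₁ refl) = _ , P , here
  ∈-prefix (step P _ _ _)   (inj₂ p) with ∈-prefix P p
  ... | j , Q , S = j , Q , there S

  On-split : {Q : Path j w} {P : Path k x} (S : Q ⊑ P) → On S y →
             ∃[ l ] Σ (Path l y) λ W → Σ (Q ⊑ W) λ S₁ → Σ (W ⊑ P) λ S₂ →
             (∀ {z} → On S₁ z → On S z) × (∀ {z} → After S₂ z → On S z)
  On-split {Q = Q} S (inj₁ refl) =
    _ , Q , here , S , (λ { (inj₁ p) → inj₁ p }) , inj₂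
  On-split {P = P} S@(there _) (inj₂ (inj₁ refl)) =
    _ , P , S , here , (λ p → p) , λ ()
  On-split (there S) (inj₂ (inj₂ p)) with On-split S (inj₂ p)
  ... | _ , W , S₁ , S₂ , f , g =
    _ , W , S₁ , there S₂ , (λ q → On-there S (f q)) ,
    λ { (inj₁ q) → inj₂ (inj₁ q) ; (inj₂ q) → On-there S (g q) }

  After? : {Q : Path j w} {P : Path k x} (S : Q ⊑ P) → ∀ y → Dec (After S y)
  After? here              y = no λ ()
  After? (there {v = v} S) y = (y Fin.≟ v) ⊎-dec After? S y

  On? : {Q : Path j w} {P : Path k x} (S : Q ⊑ P) → ∀ y → Dec (On S y)
  On? {w = w} S y = (y Fin.≟ w) ⊎-dec After? S y

  -- First hits and splicing.

  FirstHit Miss : (Fin n → Set) → Path i v → Set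
  FirstHit D A = ∃[ l ] ∃[ w ] Σ (Path l w) λ A′ →
                 A′ ⊑ A × D w × (∀ {y} → y ∈ A′ → D y → y ≡ w)
  Miss D A = ∀ {y} → y ∈ A → ¬ D y

  first-hit : {D : Fin n → Set} → (∀ y → Dec (D y)) → (A : Path i v) → FirstHit D A ⊎ Miss D A
  first-hit D? A@(start {f} _) with D? f
  ... | yes d = inj₁ (_ , _ , A , here , d , λ p _ → p)
  ... | no ¬d = inj₂ λ { refl → ¬d }
  first-hit D? P@(step {v = v} A _ _ _) with first-hit D? A
  ... | inj₁ (_ , _ , A′ , S , d , f) = inj₁ (_ , _ , A′ , there S , d , f)
  ... | inj₂ none with D? v
  ...   | yes d = inj₁ (_ , _ , P , here , d ,
                        λ { (inj₁ p) _ → p ; (inj₂ p) d′ → ⊥-elim (none p d′) })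
  ...   | no ¬d = inj₂ λ { (inj₁ refl) → ¬d ; (inj₂ p) → none p }

  -- With equal parity at `w`, the edges of `P` behind `Q` keep their kinds when appended to `A`.
  -- The length is `i + (k - j)`, stated without subtraction.
  splice-forward : {Q : Path j w} {P : Path k x} (A : Path i w) (S : Q ⊑ P) →
                   oddᵇ i ≡ oddᵇ j → (∀ {y} → y ∈ A → ¬ After S y) →
                   ∃[ m ] Σ (Path m x) λ R → oddᵇ m ≡ oddᵇ k × m + j ≡ k + i ×
                   (∀ {y} → y ∈ R → y ∈ A ⊎ After S y)
  splice-forward {j = j} {i = i} A here par _ = _ , A , par , +-comm i j , inj₁
  splice-forward A (there {e = e} {mm} {s} S) par dis
    with splice-forward A S par (λ p q → dis p (inj₂ q))
  ... | m , R , par′ , len , sub =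
    suc m , step R e (trans mm (sym par′)) fresh , cong not par′ , cong suc len ,
    λ { (inj₁ p) → inj₂ (inj₁ p) ; (inj₂ p) → [ inj₁ , (λ q → inj₂ (inj₂ q)) ]′ (sub p) }
    where
      fresh : ¬ _ ∈ R
      fresh p with sub p
      ... | inj₁ q = dis q (inj₁ refl)
      ... | inj₂ q = s (After-∈ S q)

  -- As `A` and `P` reach `x` with opposite parity, the edge due after `A` is of the kind of the
  -- last edge of `P`. The recursion moves that edge from `P` to the end of `A`. The last component
  -- locates the appended vertices.
  splice-backward : {Q : Path j w} {P : Path k x} (A : Path i x) (S : Q ⊑ P) →
                    oddᵇ i ≡ not (oddᵇ k) → (∀ {y} → y ∈ A → On S y → y ≡ x) →
                    ∃[ m ] Σ (Path m w) λ R → oddᵇ m ≡ not (oddᵇ j) × m + j ≡ k + i ×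
                    Σ (A ⊑ R) λ S′ → ∀ {y} → After S′ y → On S y
  splice-backward {j = j} {i = i} A here par _ = _ , A , par , +-comm i j , here , λ ()
  splice-backward {w = w} {i = i} A (there {k = k} {u = u} {e = e} {mm} {s} S) par dis
    with splice-backward A′ S (cong not (trans par (Bool.not-involutive _))) dis′
    where
      fresh : ¬ u ∈ A
      fresh p with On-end S | dis p
      ... | inj₁ refl | f = s (subst (_∈ _) (f (inj₁ refl)) (end-∈-⊑ S))
      ... | inj₂ q    | f = s (subst (_∈ _) (f (inj₂ (inj₂ q))) (After-∈ S q))
      A′ : Path (suc i) u
      A′ = step A (E-sym e) (M-sym (trans mm (sym (trans par (Bool.not-involutive _))))) fresh
      dis′ : ∀ {y} → y ∈ A′ → On S y → y ≡ u
      dis′ (inj₁ p) _ = p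
      dis′ (inj₂ p) (inj₁ q) = ⊥-elim (s (subst (_∈ _) (dis p (inj₁ q)) (On-∈ S (inj₁ q))))
      dis′ (inj₂ p) (inj₂ q) = ⊥-elim (s (subst (_∈ _) (dis p (inj₂ (inj₂ q))) (After-∈ S q)))
  ... | m , R , par′ , len , S′ , aft =
    m , R , par′ , trans len (+-suc k i) , ⊑-trans (there here) S′ , aft′
    where
      aft′ : ∀ {y} → After (⊑-trans (there here) S′) y → On (there {e = e} {mm} {s} S) y
      aft′ p with After-trans⁻ (there here) S′ p
      ... | inj₁ (inj₁ refl) = On-there S (On-end S)
      ... | inj₂ q           = On-there S (aft q)

  -- Levels and bounds on tenacity.

  -- Comparing lengths of one parity lets a single predicate serve for evenlevel and oddlevel; a
  -- path attaining `k` is supplied separately.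
  Lev : ℕ → Fin n → Set
  Lev k x = ∀ {k′} → Path k′ x → oddᵇ k′ ≡ oddᵇ k → k ≤ k′

  -- A path A ending on the segment [Q..P] can, from the first vertex where it
  -- meets the segment, be continued along P: forwards to the end x if A and P
  -- reach it with the same parity, backwards to the end z of Q otherwise.  In the
  -- first case minimality of P gives l′ ≤ i′.
  record Meeting {j z k x i v} (Q : Path j z) (P : Path k x) (A : Path i v) : Set where
    field
      {meeting} : Fin n
      {i′ l′}   : ℕ
      A′        : Path i′ meeting
      W         : Path l′ meeting
      A′⊑A      : A′ ⊑ A
      Q⊑W       : Q ⊑ W
      W⊑P       : W ⊑ P
      direction : (oddᵇ i′ ≡ oddᵇ l′ × l′ ≤ i′)
                  ⊎ (∃[ m ] Path m z × oddᵇ m ≡ not (oddᵇ j) × m + j ≡ l′ + i′)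

    i′≤i : i′ ≤ i
    i′≤i = ⊑-length A′⊑A

    j≤l′ : j ≤ l′
    j≤l′ = ⊑-length Q⊑W

    l′≤k : l′ ≤ k
    l′≤k = ⊑-length W⊑P

  meet : {Q : Path j z} {P : Path k x} → Lev k x → (S : Q ⊑ P) (A : Path i v) → On S v →
         Meeting Q P A
  meet {k = k} lev S A v∈S with first-hit (On? S) A
  ... | inj₂ none = ⊥-elim (none (end-∈ A) v∈S)
  ... | inj₁ (i′ , w , A′ , A′⊑A , w∈S , only) with On-split S w∈S
  ... | l , W , S₁ , S₂ , sub₁ , sub₂ = record
    { A′ = A′ ; W = W ; A′⊑A = A′⊑A ; Q⊑W = S₁ ; W⊑P = S₂ ; direction = dir }
    where
      dir : _ ⊎ _
      dir with same-or-opp (oddᵇ i′) (oddᵇ l)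
      ... | inj₁ same with splice-forward A′ S₂ same
                             (λ p q → After-∉ S₂ q (subst (_∈ W) (sym (only p (sub₂ q))) (end-∈ W)))
      ...   | m , R , par , len , _ =
        inj₁ (same , +-cancelˡ-≤ k l i′ (subst (k + l ≤_) len (+-monoˡ-≤ l (lev R par))))
      dir | inj₂ opp with splice-backward A′ S₁ opp (λ p q → only p (sub₁ q))
      ...   | m , R , par , len , _ = inj₂ (m , R , par , len)

  -- Low T v and Ge T v say t(v) < T and t(v) ≥ T; quantifying over all pairs of
  -- paths of opposite parity avoids mentioning levels, which need not exist.
  Low : ℕ → Fin n → Set
  Low T v = ∃[ a ] ∃[ b ] Path a v × Path b v × oddᵇ a ≡ not (oddᵇ b) × a + b < T

  Ge : ℕ → Fin n → Set
  Ge T v = ∀ {a b} → Path a v → Path b v → oddᵇ a ≡ not (oddᵇ b) → T ≤ a + b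

  Low-Ge : Low T v → ¬ Ge T v
  Low-Ge (_ , _ , P , Q , par , lt) ge = <⇒≱ lt (ge P Q par)

  Low-mono : t ≤ T → Low t v → Low T v
  Low-mono t≤T (_ , _ , P , Q , par , lt) = _ , _ , P , Q , par , <-≤-trans lt t≤T

  Ge-mono : t ≤ T → Ge T v → Ge t v
  Ge-mono t≤T ge P Q par = ≤-trans t≤T (ge P Q par)

  Low-orient : ∀ β → Low T v →
               ∃[ a ] ∃[ b ] Path a v × Path b v × oddᵇ a ≡ not β × oddᵇ b ≡ β × a + b < T
  Low-orient {T} β (a , b , P , Q , par , lt) with same-or-opp (oddᵇ b) β
  ... | inj₁ refl = a , b , P , Q , par , refl , lt
  ... | inj₂ opp  = b , a , Q , P , opp , trans par (sym (flip-not opp)) , subst (_< T) (+-comm a b) lt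

  -- Simplicity forces the list `L`: once the last vertex `v` is stripped, the rest of the path has
  -- to avoid `v` too.
  path-avoiding? : ∀ k v (L : List (Fin n)) → Dec (Σ (Path k v) λ P → All (λ y → ¬ y ∈ P) L)
  path-avoiding? zero v L =
    map′ (λ { (f , p) → start f , p }) (λ { (start f , p) → f , p })
         (Fin.all? (λ y → M v y Bool.≟ false) ×-dec All.all? (λ y → ¬? (y Fin.≟ v)) L)
  path-avoiding? (suc k) v L =
    map′ to from
         (All.all? (λ y → ¬? (y Fin.≟ v)) L ×-dec
          Fin.any? λ u → (E u v Bool.≟ true) ×-dec (M u v Bool.≟ oddᵇ k) ×-dec
                         path-avoiding? k u (v ∷ L))
    where
      Extension : Set
      Extension = All (λ y → ¬ y ≡ v) L ×
                  ∃[ u ] E u v ≡ true × M u v ≡ oddᵇ k ×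
                         Σ (Path k u) λ P → All (λ y → ¬ y ∈ P) (v ∷ L)
      to : Extension → Σ (Path (suc k) v) λ P → All (λ y → ¬ y ∈ P) L
      to (≢v , u , e , m , P , s ∷ ∉P) =
        step P e m s , All.zipWith (λ (p , q) → [ p , q ]′) (≢v , ∉P)
      from : (Σ (Path (suc k) v) λ P → All (λ y → ¬ y ∈ P) L) → Extension
      from (step P e m s , p) =
        All.map (_∘ inj₁) p , _ , e , m , P , s ∷ All.map (_∘ inj₂) p

  path? : ∀ k v → Dec (Path k v)
  path? k v = map′ proj₁ (_, []) (path-avoiding? k v [])

  Low? : ∀ T v → Dec (Low T v)
  Low? T v =
    map′ (λ { (a , _ , b , _ , r) → a , b , r })
         (λ { (a , b , r@(_ , _ , _ , lt)) →
              a , m+n≤o⇒m≤o (suc a) lt , b , ≤-<-trans (m≤n+m b a) lt , r })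
         (anyUpTo? (λ a → anyUpTo? (λ b →
            path? a v ×-dec path? b v ×-dec (oddᵇ a Bool.≟ not (oddᵇ b)) ×-dec (a + b <? T)) T) T)

  ¬Low⇒Ge : ¬ Low T v → Ge T v
  ¬Low⇒Ge ¬low P Q par = ≮⇒≥ λ lt → ¬low (_ , _ , P , Q , par , lt)

  shortest : Path k x → ∃[ l ] Path l x × oddᵇ l ≡ oddᵇ k × l ≤ k × Lev l x
  shortest {k} {x} = <-rec (λ k → Path k x → _) search k
    where
      search : ∀ k → (∀ {k′} → k′ < k → Path k′ x →
                       ∃[ l ] Path l x × oddᵇ l ≡ oddᵇ k′ × l ≤ k′ × Lev l x) →
               Path k x → ∃[ l ] Path l x × oddᵇ l ≡ oddᵇ k × l ≤ k × Lev l x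
      search k rec P with anyUpTo? (λ k′ → path? k′ x ×-dec (oddᵇ k′ Bool.≟ oddᵇ k)) k
      ... | no none = k , P , refl , ≤-refl , λ P′ par → ≮⇒≥ λ lt → none (_ , lt , P′ , par)
      ... | yes (k′ , lt , P′ , par) with rec lt P′
      ...   | l , Q , par′ , l≤k′ , lev = l , Q , trans par′ par , ≤-trans l≤k′ (<⇒≤ lt) , lev

  -- The pair of paths in `low`, ordered by parity, is at least as long as the two levels.
  opposite-level : Lev k x → Low T x →
                   ∃[ k′ ] Path k′ x × oddᵇ k ≡ not (oddᵇ k′) × Lev k′ x × k + k′ < T
  opposite-level {k} {T = T} lev low with Low-orient (oddᵇ k) low
  ... | a , b , P , Q , parP , parQ , lt with shortest P
  ... | l , P′ , par , l≤a , lev′ =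
    l , P′ , flip-not (trans par parP) , lev′ ,
    ≤-<-trans (+-mono-≤ (lev Q parQ) l≤a) (subst (_< T) (+-comm a b) lt)

  -- Consequences of splicing into a shortest path.

  -- Let `O` be a shorter path to `b` of the parity of `Q`. Splicing `P′` backwards gives a path
  -- that with `O` contradicts `ge`; otherwise `j ≤ k′`. Then `O` itself is spliced: forwards is
  -- excluded by its length, and backwards gives a path shorter than `k`, again contradicting `ge`
  -- together with `O`.
  honest : {Q : Path j b} {P : Path k x} → Lev k x → Q ⊑ P → Path k′ x →
           Ge (k + k′) b → Lev j b
  honest {j} {k = k} {k′ = k′} lev S P′ ge {o} O par = ≮⇒≥ λ o<j → case₁ o<j (meet lev S P′ (On-end S))
    where
      module Me = Meeting
      case₂ : o < j → j ≤ k′ → Meeting _ _ O → ⊥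
      case₂ o<j j≤k′ N with Me.direction N
      ... | inj₁ (_ , l≤i) = <⇒≱ o<j (≤-trans (Me.j≤l′ N) (≤-trans l≤i (Me.i′≤i N)))
      ... | inj₂ (m , R , parR , len) =
        <⇒≱ (<-trans (+-monoˡ-< o m<k) (+-monoʳ-< k (<-≤-trans o<j j≤k′)))
            (ge R O (trans parR (cong not (sym par))))
        where
          m<k : m < k
          m<k = +-cancelʳ-< j m k (subst (_< k + j) (sym len)
                  (≤-<-trans (+-mono-≤ (Me.l′≤k N) (Me.i′≤i N)) (+-monoʳ-< k o<j)))
      case₁ : o < j → Meeting _ _ P′ → ⊥
      case₁ o<j N with Me.direction N
      ... | inj₁ (_ , l≤i) =
        case₂ o<j (≤-trans (Me.j≤l′ N) (≤-trans l≤i (Me.i′≤i N))) (meet lev S O (inj₁ refl))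
      ... | inj₂ (m , R , parR , len) =
        <⇒≱ (+-monoʳ-< m o<j)
            (≤-trans (subst (_≤ k + k′) (sym len) (+-mono-≤ (Me.l′≤k N) (Me.i′≤i N)))
                     (ge R O (trans parR (cong not (sym par)))))

  -- Together with P this shows that the edge of P entering z has tenacity < T.
  arrival : {Z : Path j z} {P : Path k x} → Lev k x → (S : Z ⊑ P) → Path i v → On S v →
            k + i < T → Low T z → ∃[ a ] Path a z × oddᵇ a ≡ not (oddᵇ j) × a + j < T
  arrival {j} {z} {k} {T = T} lev S P₁ v∈S k+i<T low with meet lev S P₁ v∈S
  ... | N with Meeting.direction N
  ... | inj₂ (m , R , par , len) =
    m , R , par , subst (_< T) (sym len) (≤-<-trans (+-mono-≤ (Meeting.l′≤k N) (Meeting.i′≤i N)) k+i<T)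
  -- A forward meeting only yields `j ≤ i`. The opposite path comes from `low` if its partner `O`
  -- has length at least `j`; a shorter `O` must splice backwards.
  ... | inj₁ (_ , l≤i) with Low-orient (oddᵇ j) low
  ... | a , o , A , O , parA , parO , lt with j ≤? o
  ...   | yes j≤o = a , A , parA , ≤-<-trans (+-monoʳ-≤ a j≤o) lt
  ...   | no  j≰o with meet lev S O (inj₁ refl)
  ...     | N′ with Meeting.direction N′
  ...       | inj₁ (_ , l≤i′) =
    ⊥-elim (j≰o (≤-trans (Meeting.j≤l′ N′) (≤-trans l≤i′ (Meeting.i′≤i N′))))
  ...       | inj₂ (m , R , par , len) =
    m , R , par , subst (_< T) (sym len)
      (≤-<-trans (+-mono-≤ (Meeting.l′≤k N′)
        (≤-trans (Meeting.i′≤i N′) (≤-trans (<⇒≤ (≰⇒> j≰o)) j≤i))) k+i<T)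
    where
      j≤i : j ≤ _
      j≤i = ≤-trans (Meeting.j≤l′ N) (≤-trans l≤i (Meeting.i′≤i N))

  -- Matched edges along a path.

  next : {Q : Path j w} {P : Path k x} (S : Q ⊑ P) → j ≡ k × w ≡ x ⊎
         ∃[ y ] Σ (E w y ≡ true) λ e → Σ (M w y ≡ oddᵇ j) λ m → Σ (¬ y ∈ Q) λ s →
         step Q e m s ⊑ P × After S y
  next here = inj₁ (refl , refl)
  next (there {e = e} {m} {s} S) with next S
  next (there {e = e} {m} {s} here) | _ = inj₂ (_ , e , m , s , here , inj₁ refl)
  next (there (there S)) | inj₁ (refl , _) = ⊥-elim (1+n≰n (⊑-length S))
  next (there (there S)) | inj₂ (y , e , m , s , S′ , p) = inj₂ (y , e , m , s , there S′ , inj₂ p)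

  -- The length is not 0 because `v` is matched, so the last edge is the matched edge at `v`.
  even-end : (P : Path k v) → Even k → M u v ≡ true →
             ∃[ j ] Σ (Path j u) λ Q → Q ⊑ P × suc j ≡ k
  even-end {u = u} (start f) _ m = ⊥-elim (false≢true (f u) (M-sym m))
  even-end (step {u = u′} Q _ m′ _) ev m
    with mate-unique (trans m′ (flip-not (sym ev))) m
  ... | refl = _ , Q , there here , refl

  -- At an even position `v` would be preceded by its mate `u`, against simplicity. At an odd
  -- position it would be followed by `u`, which then ends `P` at an even length.
  odd-end : (P : Path k u) → Odd k → M u v ≡ true → ¬ v ∈ P
  odd-end P od m v∈P with ∈-prefix P v∈P
  ... | l , W , S with oddᵇ l in eq
  ... | false with even-end W eq m
  ...   | j , Q , S′ , refl = 1+n≰n (subst (_ ≤_) (sym (⊑-same-end (⊑-trans S′ S))) (⊑-length S))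
  odd-end P od m v∈P | l , W , S | true with next S
  ... | inj₁ (_ , refl) =
    false≢true (IsGraph.irreflexive graph _) (IsMatching.sub matching _ _ m)
  ... | inj₂ (y , e , m′ , s , S′ , _) with mate-unique m (M-sym (trans m′ eq))
  ...   | refl with ⊑-same-end S′
  ...     | refl = false≢true (cong not eq) od

  -- Dropping the matched edge from the even path and appending it to the odd one keeps the sum of
  -- the lengths.
  Low-mate : M u v ≡ true → Low T v → Low T u
  Low-mate {T = T} m low with Low-orient true low
  ... | a , b , P , Q , parP , parQ , lt with even-end P parP m
  ... | j , P′ , _ , refl =
    j , suc b , P′ ,
    step Q (E-sym (IsMatching.sub matching _ _ m)) (trans (M-sym m) (sym parQ))
         (odd-end Q parQ (M-sym m)) ,
    trans (flip-not (sym parP)) (sym (cong (not ∘ not) parQ)) ,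
    subst (_< T) (sym (+-suc j b)) lt

  -- Connection by edges of small tenacity.

  -- Edges of tenacity < T.
  data Γ (T : ℕ) (u v : Fin n) : Set where
    unmatched : E u v ≡ true → M u v ≡ false → Path i u → Path j v → Even i → Even j →
                suc (i + j) < T → Γ T u v
    matched   : M u v ≡ true → Low T u → Γ T u v

  Conn : ℕ → Fin n → Fin n → Set
  Conn T = Star (Γ T)

  -- Walks back from `w` to `b`. A matched edge has a low end by hypothesis; for an unmatched one,
  -- `arrival` gives an even path to its later end and the prefix is an even path to its earlier
  -- end. Keeping `P` fixed while `W` shrinks allows the induction.
  suffix-connected :
    {B : Path l b} {W : Path j w} {P : Path k x} → Lev k x → Path i v → k + i < T →
    (S : W ⊑ P) → On S v → (S′ : B ⊑ W) → (∀ {y} → After S′ y → Low T y) → Conn T w b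
  suffix-connected lev P₁ lt S v∈S here _ = ε
  suffix-connected {T = T} lev P₁ lt S v∈S (there {k = k} {P = Y} {e} {m} S′) low =
    edge ◅ suffix-connected lev P₁ lt (⊑-trans (there here) S) (On-unstep S v∈S) S′ (low ∘ inj₂)
    where
      edge : Γ T _ _
      edge with even-or-odd k
      ... | inj₂ odd  = matched (M-sym (trans m odd)) (low (inj₁ refl))
      ... | inj₁ even with arrival lev S P₁ v∈S lt (low (inj₁ refl))
      ...   | a , A , par , lt′ =
        unmatched (E-sym e) (M-sym (trans m even)) A Y (trans par (cong (not ∘ not) even)) even
                  (subst (_< T) (+-suc a k) lt′)

  -- The last vertex of tenacity at least `T` on a path.

  record LastGe (T : ℕ) (P : Path k x) : Set where
    constructor last-ge
    field
      {base} : Fin n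
      {len}  : ℕ
      pre    : Path len base
      sub    : pre ⊑ P
      ge     : Ge T base
      low    : ∀ {y} → After sub y → Low T y

  open LastGe

  restrict : {Q : Path j w} {P : Path k x} (L : LastGe T P) → pre L ⊑ Q → Q ⊑ P → LastGe T Q
  restrict L S S′ = last-ge (pre L) S (ge L)
    λ p → low L (∈-After (sub L) (∈-⊑ S′ (After-∈ S p)) (After-∉ S p))

  last-ge-maximal : {Q : Path j w} {P : Path k x} (L : LastGe T P) → Q ⊑ P → Ge T w → Q ⊑ pre L
  last-ge-maximal (last-ge B here ge low)      S         ge′ = S
  last-ge-maximal (last-ge B (there S′) ge low) here      ge′ = ⊥-elim (Low-Ge (low (inj₁ refl)) ge′)
  last-ge-maximal (last-ge B (there S′) ge low) (there S) ge′ =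
    last-ge-maximal (last-ge B S′ ge (low ∘ inj₂)) S ge′

  last-ge-end : {P : Path k x} (L : LastGe T P) → Ge T x → base L ≡ x
  last-ge-end (last-ge B here ge low)      _   = refl
  last-ge-end (last-ge B (there S) ge low) ge′ = ⊥-elim (Low-Ge (low (inj₁ refl)) ge′)

  -- If the path left the base by a matched edge, the next vertex, and hence its mate the base,
  -- would be low.
  last-ge-even : {P : Path k x} (L : LastGe T P) → Even k → Even (len L)
  last-ge-even L ev with next (sub L)
  ... | inj₁ (refl , _) = ev
  ... | inj₂ (y , e , m , s , _ , p) with even-or-odd (len L)
  ...   | inj₁ even = even
  ...   | inj₂ odd  = ⊥-elim (Low-Ge (Low-mate (trans m odd) (low L p)) (ge L))

  last-ge-connected : {P : Path k x} → Lev k x → (L : LastGe T P) → Conn T x (base L)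
  last-ge-connected lev (last-ge B here _ _) = ε
  last-ge-connected lev L@(last-ge B S@(there _) _ low) with opposite-level lev (low (inj₁ refl))
  ... | k′ , P′ , _ , _ , lt = suffix-connected lev P′ lt here (inj₁ refl) S low

  last-ge-level : {P : Path k x} → Lev k x → (L : LastGe T P) → Lev (len L) (base L)
  last-ge-level lev (last-ge B here _ _) = lev
  last-ge-level lev (last-ge B S@(there _) ge low) with opposite-level lev (low (inj₁ refl))
  ... | k′ , P′ , _ , _ , lt = honest lev S P′ (Ge-mono (<⇒≤ lt) ge)

  -- Two shortest paths whose segments from b and c meet each other have a
  -- common vertex on both segments: each path reaches its first meeting point
  -- no sooner than the other one, so the meeting points cannot both lie before
  -- b and c.
  record Crossing {l b k x l′ c k′ x′} (B : Path l b) (P : Path k x)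
                  (C : Path l′ c) (P′ : Path k′ x′) : Set where
    constructor crossing
    field
      {vertex} : Fin n
      {g g′}   : ℕ
      {V}      : Path g vertex
      {V′}     : Path g′ vertex
      B⊑V      : B ⊑ V
      V⊑P      : V ⊑ P
      C⊑V′     : C ⊑ V′
      V′⊑P′    : V′ ⊑ P′
      parity   : oddᵇ g ≡ oddᵇ g′

  cross : {B : Path l b} {P : Path k x} {C : Path m c} {P′ : Path k′ y}
          {A : Path i v} {A′ : Path j w} →
          Lev k x → Lev k′ y → (S : B ⊑ P) (S′ : C ⊑ P′) → Ge T b → Ge T c → k + k′ < T →
          A ⊑ P′ → On S v → A′ ⊑ P → On S′ w → Crossing B P C P′
  cross {l} {k = k} {m = m} {k′ = k′} {B = B} {C = C} lev lev′ S S′ geB geC lt A⊑P′ v∈S A′⊑P w∈S′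
    with meet lev S _ v∈S | meet lev′ S′ _ w∈S′
  ... | N | N′ with Meeting.direction N | Meeting.direction N′
  -- Splicing backwards would give, with the prefix `B`, two paths to `b` of opposite parity and
  -- total length at most `k + k′ < T`.
  ... | inj₂ (_ , R , par , len) | _ =
    ⊥-elim (<⇒≱ lt (≤-trans (geB R B par) (subst (_≤ k + k′) (sym len)
      (+-mono-≤ (Meeting.l′≤k N) (≤-trans (Meeting.i′≤i N) (⊑-length A⊑P′))))))
  ... | inj₁ _ | inj₂ (_ , R , par , len) =
    ⊥-elim (<⇒≱ lt (≤-trans (geC R C par) (subst (_≤ k + k′) (sym len) (≤-trans
      (+-mono-≤ (Meeting.l′≤k N′) (≤-trans (Meeting.i′≤i N′) (⊑-length A′⊑P)))
      (≤-reflexive (+-comm k′ k))))))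
  ... | inj₁ (par , l₁≤i₁) | inj₁ (par′ , l₂≤i₂) with l ≤? Meeting.i′ N′
  ...   | yes l≤i₂ = crossing (⊑-compare S hit l≤i₂) hit (Meeting.Q⊑W N′) (Meeting.W⊑P N′) par′
    where hit = ⊑-trans (Meeting.A′⊑A N′) A′⊑P
  ...   | no  l≰i₂ = crossing (Meeting.Q⊑W N) (Meeting.W⊑P N) (⊑-compare S′ hit m≤i₁) hit (sym par)
    where
      hit = ⊑-trans (Meeting.A′⊑A N) A⊑P′
      m≤i₁ : m ≤ Meeting.i′ N
      m≤i₁ = ≤-trans (Meeting.j≤l′ N′) (≤-trans l₂≤i₂ (≤-trans (<⇒≤ (≰⇒> l≰i₂))
               (≤-trans (Meeting.j≤l′ N) l₁≤i₁)))

  -- Uniqueness of the connected vertex of large tenacity, by induction on the bound.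

  ConnUnique : ℕ → Set
  ConnUnique T = ∀ {v b c} → Conn T v b → Conn T v c → Ge T b → Ge T c → b ≡ c

  -- The bound by the length of augmenting paths enters as `start-ge`; it ensures that each path
  -- contains a vertex of large tenacity.
  module Bounded (ℓ : ℕ) (start-ge : ∀ {f} → Unmatched E M f → Ge (suc ℓ) f) where

    find-last-ge : T ≤ suc ℓ → (P : Path k x) → LastGe T P
    find-last-ge T≤ P@(start f) = last-ge P here (Ge-mono T≤ (start-ge f)) λ ()
    find-last-ge {T} T≤ R@(step {v = v} P _ _ _) with Low? T v
    ... | no ¬low = last-ge R here (¬Low⇒Ge ¬low) λ ()
    ... | yes low with find-last-ge T≤ P
    ...   | last-ge B S ge lows = last-ge B (there S) ge λ { (inj₁ refl) → low ; (inj₂ p) → lows p }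

    module Step (t : ℕ) (t≤ℓ : t ≤ ℓ) (conn-unique : ConnUnique t) where

      -- Here `x` has tenacity exactly `t`. The fuel `N` bounds the shorter of the two paths.
      Agree : ℕ → Set
      Agree N = ∀ {x k k′} (R : Path k x) (R′ : Path k′ x) → Lev k x → Lev k′ x →
                oddᵇ k ≡ not (oddᵇ k′) → k + k′ ≡ t → (k < N ⊎ k′ < N) →
                (L : LastGe (suc t) R) (L′ : LastGe (suc t) R′) → base L ≡ base L′

      -- If `a` has tenacity above `t`, it is itself both bases. Otherwise its tenacity is `t`, and
      -- both paths are compared with a shortest path `U` of the other parity.
      agree-same-parity : ∀ {N} → Agree N → Ge t a → (A : Path i a) (A′ : Path j a) →
                          Lev i a → Lev j a → oddᵇ i ≡ oddᵇ j → i < N →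
                          (L : LastGe (suc t) A) (L′ : LastGe (suc t) A′) → base L ≡ base L′
      agree-same-parity {a} {i} agree geA A A′ lev lev′ par i<N L L′ with Low? (suc t) a
      ... | no ¬low = trans (last-ge-end L (¬Low⇒Ge ¬low)) (sym (last-ge-end L′ (¬Low⇒Ge ¬low)))
      ... | yes low with ≤-antisym (lev A′ (sym par)) (lev′ A par)
      ...   | refl with opposite-level lev low
      ...     | h , U , opp , levU , lt =
        trans (agree A U lev levU opp i+h≡t (inj₁ i<N) L LU)
              (sym (agree A′ U lev′ levU opp i+h≡t (inj₁ i<N) L′ LU))
        where
          i+h≡t : i + h ≡ t
          i+h≡t = ≤-antisym (s≤s⁻¹ lt) (geA A U opp)
          LU = find-last-ge (s≤s t≤ℓ) U

      -- The paths cross at a vertex `v` other than `x`, reached with equal parity. From `v` both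
      -- lead back, over edges of tenacity below `t`, to their last vertices of tenacity at least
      -- `t`, which coincide by `conn-unique`. The prefixes ending there are strictly shorter, so
      -- the induction applies to them.
      agree : ∀ N → Agree N
      agree zero _ _ _ _ _ _ (inj₁ ())
      agree zero _ _ _ _ _ _ (inj₂ ())
      agree (suc N) {x} {k} {k′} R R′ lev lev′ opp k+k′≡t fuel L L′
        with cross lev lev′ (sub L) (sub L′) (ge L) (ge L′) (s≤s (≤-reflexive k+k′≡t))
                   here (On-end (sub L)) here (On-end (sub L′))
      ... | crossing {v} {g} {g′} {V} {V′} B⊑V V⊑R C⊑V′ V′⊑R′ par =
        go (conn-unique
             (suffix-connected lev  V′ lt  V⊑R   (inj₁ refl) (sub LA)  (low LA))
             (suffix-connected lev′ V  lt′ V′⊑R′ (inj₁ refl) (sub LA′) (low LA′))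
             (ge LA) (ge LA′))
        where
          LA  = find-last-ge (m≤n⇒m≤1+n t≤ℓ) V
          LA′ = find-last-ge (m≤n⇒m≤1+n t≤ℓ) V′
          v≢x : v ≢ x
          v≢x refl with ⊑-same-end V⊑R | ⊑-same-end V′⊑R′
          ... | refl | refl = x≢not-x (trans (sym par) opp)
          g<k : g < k
          g<k = ⊑-shorter V⊑R v≢x
          g′<k′ : g′ < k′
          g′<k′ = ⊑-shorter V′⊑R′ v≢x
          lt : k + g′ < t
          lt = subst (k + g′ <_) k+k′≡t (+-monoʳ-< k g′<k′)
          lt′ : k′ + g < t
          lt′ = subst (k′ + g <_) (trans (+-comm k′ k) k+k′≡t) (+-monoʳ-< k′ g<k)
          A⊑R : pre LA ⊑ R
          A⊑R = ⊑-trans (sub LA) V⊑R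
          A′⊑R′ : pre LA′ ⊑ R′
          A′⊑R′ = ⊑-trans (sub LA′) V′⊑R′
          levA : Lev (len LA) (base LA)
          levA = honest lev A⊑R R′ (Ge-mono (≤-reflexive k+k′≡t) (ge LA))
          levA′ : Lev (len LA′) (base LA′)
          levA′ = honest lev′ A′⊑R′ R (Ge-mono (≤-reflexive (trans (+-comm k′ k) k+k′≡t)) (ge LA′))
          -- `base L` has tenacity above `t`, so it comes no later than `base LA` and survives the
          -- restriction.
          LB : LastGe (suc t) (pre LA)
          LB = restrict L (last-ge-maximal LA B⊑V (Ge-mono (n≤1+n t) (ge L))) A⊑R
          LC : LastGe (suc t) (pre LA′)
          LC = restrict L′ (last-ge-maximal LA′ C⊑V′ (Ge-mono (n≤1+n t) (ge L′))) A′⊑R′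
          len<k : len LA < k
          len<k = ≤-<-trans (⊑-length (sub LA)) g<k
          len′<k′ : len LA′ < k′
          len′<k′ = ≤-<-trans (⊑-length (sub LA′)) g′<k′
          conclude : ∀ {a} (A′ : Path (len LA′) a) → a ≡ base LA → Lev (len LA′) a →
                     (LC′ : LastGe (suc t) A′) → base L ≡ base LC′
          conclude A′ refl levA″ LC′ with same-or-opp (oddᵇ (len LA)) (oddᵇ (len LA′))
          ... | inj₂ opp′ = ⊥-elim (<⇒≱ (subst (len LA + len LA′ <_) k+k′≡t (+-mono-< len<k len′<k′))
                                       (ge LA (pre LA) A′ opp′))
          ... | inj₁ same = agree-same-parity (agree N) (ge LA) (pre LA) A′ levA levA″ same len<N LB LC′
            where
              -- If the fuel bounds `k′` instead of `k`, minimality of `len LA` transfers the bound.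
              len<N : len LA < N
              len<N = [ (λ k< → <-≤-trans len<k (s≤s⁻¹ k<))
                      , (λ k′< → ≤-<-trans (levA A′ (sym same)) (<-≤-trans len′<k′ (s≤s⁻¹ k′<))) ]′ fuel
          go : base LA ≡ base LA′ → base L ≡ base L′
          go eq = conclude (pre LA′) (sym eq) levA′ LC

      agree′ : (R : Path k x) (R′ : Path k′ x) → Lev k x → Lev k′ x →
               oddᵇ k ≡ not (oddᵇ k′) → k + k′ ≡ t →
               (L : LastGe (suc t) R) (L′ : LastGe (suc t) R′) → base L ≡ base L′
      agree′ {k} R R′ lev lev′ opp eq = agree (suc k) R R′ lev lev′ opp eq (inj₁ ≤-refl)

      t≤1+ℓ : t ≤ suc ℓ
      t≤1+ℓ = m≤n⇒m≤1+n t≤ℓ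

      last-ge-restrict : {P : Path k x} (La : LastGe t P) → LastGe (suc t) P → LastGe (suc t) (pre La)
      last-ge-restrict La L = restrict L (last-ge-maximal La (sub L) (Ge-mono (n≤1+n t) (ge L))) (sub La)

      -- Both bases at bound `t` are reached at even length by `last-ge-even`, so the prefixes are
      -- shortest paths of one parity to one vertex.
      lift : {P : Path k u} {P′ : Path k′ v} → Even k → Even k′ → Lev k u → Lev k′ v →
             (La : LastGe t P) (La′ : LastGe t P′) → base La ≡ base La′ →
             (L : LastGe (suc t) P) (L′ : LastGe (suc t) P′) → base L ≡ base L′
      lift ev ev′ lev lev′ La La′ eq L L′ =
        go (pre La′) (sym eq) (last-ge-level lev′ La′) (last-ge-restrict La′ L′)
        where
          go : ∀ {a} (A′ : Path (len La′) a) → a ≡ base La → Lev (len La′) a →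
               (L″ : LastGe (suc t) A′) → base L ≡ base L″
          go A′ refl levA′ L″ =
            agree-same-parity (agree _) (ge La) (pre La) A′ (last-ge-level lev La) levA′
              (trans (last-ge-even La ev) (sym (last-ge-even La′ ev′))) ≤-refl (last-ge-restrict La L) L″

      -- If the path to u misses the end segment of the path to v, it extends
      -- through the edge uv and back along that segment to its first vertex.
      bridge : {P : Path k u} {P′ : Path k′ v} → E u v ≡ true → M u v ≡ false →
               Even k → Even k′ → Lev k u → Lev k′ v → suc (k + k′) ≤ t →
               (La : LastGe t P′) → Miss (On (sub La)) P →
               (L : LastGe (suc t) P) (L′ : LastGe (suc t) P′) → base L ≡ base L′
      bridge {k} {u} {k′} {v} {P} e m ev ev′ lev lev′ lt La miss L L′
        with splice-backward A (sub La) (trans (cong not ev) (cong not (sym ev′)))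
               (λ { (inj₁ p) _ → p ; (inj₂ p) q → ⊥-elim (miss p q) })
        where
          A : Path (suc k) v
          A = step P e (trans m (sym ev)) (λ p → miss p (On-end (sub La)))
      ... | o , R , par , length , A⊑R , aft =
        sym (agree′ (pre La) R (last-ge-level lev′ La) levR (flip-not par) sum (last-ge-restrict La L′) LR)
        where
          o+len≤t : o + len La ≤ t
          o+len≤t = subst (_≤ t) (sym (trans length (trans (+-suc k′ k) (cong suc (+-comm k′ k))))) lt
          -- `ge La` turns the bound into an equality: `base La` has tenacity `t`, and `R` is
          -- shortest of its parity.
          sum : len La + o ≡ t
          sum = trans (+-comm (len La) o) (≤-antisym o+len≤t (ge La R (pre La) par))
          levR : Lev o (base La)
          levR R₂ par₂ = +-cancelʳ-≤ (len La) o _ (≤-trans o+len≤t (ge La R₂ (pre La) (trans par₂ par)))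
          -- At bound `suc t` even `base La` is low, so the last high vertex of `R` is the one of
          -- `P`.
          low-on : ∀ {y} → On (sub La) y → Low (suc t) y
          low-on (inj₁ refl) = o , _ , R , pre La , par , s≤s o+len≤t
          low-on (inj₂ p)    = Low-mono (n≤1+n t) (low La p)
          P⊑R : P ⊑ R
          P⊑R = ⊑-trans (there here) A⊑R
          low-R : ∀ {y} → After (⊑-trans (sub L) P⊑R) y → Low (suc t) y
          low-R p with After-trans⁻ (sub L) P⊑R p
          ... | inj₁ q = low L q
          ... | inj₂ q with After-trans⁻ (there here) A⊑R q
          ...   | inj₁ (inj₁ refl) = low-on (On-end (sub La))
          ...   | inj₂ r           = low-on (aft r)
          LR : LastGe (suc t) R
          LR = last-ge (pre L) (⊑-trans (sub L) P⊑R) (ge L) low-R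

      -- For an unmatched edge, one path misses the end segment of the other and `bridge` applies,
      -- or they cross and `conn-unique` gives equal bases at bound `t`. A matched edge of tenacity
      -- below `t` is covered by `conn-unique`; at tenacity `t`, `P′` without its last edge is a
      -- shortest odd path to `u`, to be compared with `P`.
      edge-agree : Γ (suc t) u v → {P : Path k u} {P′ : Path k′ v} → Even k → Even k′ →
                   Lev k u → Lev k′ v →
                   (L : LastGe (suc t) P) (L′ : LastGe (suc t) P′) → base L ≡ base L′
      edge-agree {u} {v} {k} {k′} (unmatched e m Pu Pv evu evv lt) {P} {P′} ev ev′ lev lev′ L L′ =
        hits (first-hit (On? (sub La′)) P) (first-hit (On? (sub La)) P′)
        where
          La  = find-last-ge t≤1+ℓ P
          La′ = find-last-ge t≤1+ℓ P′
          k+k′<t : k + k′ < t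
          k+k′<t = s≤s⁻¹ (≤-<-trans (s≤s (+-mono-≤ (lev Pu (trans evu (sym ev)))
                                                    (lev′ Pv (trans evv (sym ev′))))) lt)
          k′+k<t : k′ + k < t
          k′+k<t = subst (_< t) (+-comm k k′) k+k′<t
          hits : FirstHit (On (sub La′)) P ⊎ Miss (On (sub La′)) P →
                 FirstHit (On (sub La)) P′ ⊎ Miss (On (sub La)) P′ → base L ≡ base L′
          hits (inj₂ miss) _ = bridge e m ev ev′ lev lev′ k+k′<t La′ miss L L′
          hits (inj₁ _) (inj₂ miss) = sym (bridge (E-sym e) (M-sym m) ev′ ev lev′ lev k′+k<t La miss L′ L)
          hits (inj₁ (_ , _ , _ , H⊑P , on , _)) (inj₁ (_ , _ , _ , H′⊑P′ , on′ , _))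
            with cross lev lev′ (sub La) (sub La′) (ge La) (ge La′) k+k′<t H′⊑P′ on′ H⊑P on
          ... | crossing {V = V} {V′} B⊑V V⊑P C⊑V′ V′⊑P′ _ =
            lift ev ev′ lev lev′ La La′
              (conn-unique
                (suffix-connected lev V′ (≤-<-trans (+-monoʳ-≤ k (⊑-length V′⊑P′)) k+k′<t) V⊑P (inj₁ refl)
                  B⊑V (low (restrict La B⊑V V⊑P)))
                (suffix-connected lev′ V (≤-<-trans (+-monoʳ-≤ k′ (⊑-length V⊑P)) k′+k<t) V′⊑P′ (inj₁ refl)
                  C⊑V′ (low (restrict La′ C⊑V′ V′⊑P′)))
                (ge La) (ge La′))
              L L′
      edge-agree {u} {v} {k} {k′} (matched m lowu) {P} {P′} ev ev′ lev lev′ L L′ with Low? t u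
      ... | yes lowu′ =
        lift ev ev′ lev lev′ La La′
          (conn-unique (last-ge-connected lev La) (matched m lowu′ ◅ last-ge-connected lev′ La′)
                       (ge La) (ge La′)) L L′
        where
          La  = find-last-ge t≤1+ℓ P
          La′ = find-last-ge t≤1+ℓ P′
      ... | no ¬low with even-end P′ ev′ m
      ...   | o , Q , Q⊑P′ , refl =
        agree′ P Q lev levQ opp (≤-antisym (s≤s⁻¹ k+o<1+t) (¬Low⇒Ge ¬low P Q opp)) L
          (restrict L′ (⊑-compare (sub L′) Q⊑P′ (s≤s⁻¹ (⊑-shorter (sub L′) base≢v))) Q⊑P′)
        where
          odd-o : Odd o
          odd-o = flip-not (sym ev′)
          opp : oddᵇ k ≡ not (oddᵇ o)
          opp = trans ev (sym (cong not odd-o))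
          levQ : Lev o u
          levQ O par = s≤s⁻¹ (lev′ (step O (IsMatching.sub matching _ _ m) (trans m (sym odd-O))
                                         (odd-end O odd-O m)) (cong not par))
            where odd-O = trans par odd-o
          k+o<1+t : k + o < suc t
          k+o<1+t with opposite-level lev lowu
          ... | o′ , O , opp′ , _ , lt =
            ≤-<-trans (+-monoʳ-≤ k (levQ O (trans (flip-not opp′) (sym (flip-not opp))))) lt
          base≢v : base L′ ≢ v
          base≢v eq = Low-Ge (Low-mate (M-sym m) lowu) (subst (Ge (suc t)) eq (ge L′))

      even-path : Γ (suc t) u v → (∃[ a ] Path a u × Even a) × (∃[ b ] Path b v × Even b)
      even-path (unmatched _ _ Pu Pv evu evv _) = (_ , Pu , evu) , (_ , Pv , evv)
      even-path (matched m lowu) with Low-orient true lowu | Low-orient true (Low-mate (M-sym m) lowu)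
      ... | _ , _ , P , _ , ev , _ | _ , _ , P′ , _ , ev′ , _ = (_ , P , ev) , (_ , P′ , ev′)

      -- The base of a shortest even path is invariant along the edges, and at `c` it is `c` itself.
      conn-base : Conn (suc t) u c → Ge (suc t) c → {P : Path k u} → Even k → Lev k u →
                  (L : LastGe (suc t) P) → base L ≡ c
      conn-base ε          geC ev lev L = last-ge-end L geC
      conn-base (edge ◅ r) geC ev lev L with proj₂ (even-path edge)
      ... | _ , Pv , evv with shortest Pv
      ...   | _ , P′ , par , _ , lev′ =
        trans (edge-agree edge ev (trans par evv) lev lev′ L L′) (conn-base r geC (trans par evv) lev′ L′)
        where L′ = find-last-ge (s≤s t≤ℓ) P′

      conn-unique-suc : ConnUnique (suc t)
      conn-unique-suc ε ε _ _ = refl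
      conn-unique-suc r@(edge ◅ _) r′ geB geC = meeting-base edge r r′ geB geC
        where
          meeting-base : Γ (suc t) u v → Conn (suc t) u b → Conn (suc t) u c →
                         Ge (suc t) b → Ge (suc t) c → b ≡ c
          meeting-base edge r r′ geB geC with proj₁ (even-path edge)
          ... | _ , Pu , evu with shortest Pu
          ...   | _ , P , par , _ , lev =
            trans (sym (conn-base r geB (trans par evu) lev L)) (conn-base r′ geC (trans par evu) lev L)
            where L = find-last-ge (s≤s t≤ℓ) P
      conn-unique-suc ε r′@(_ ◅ _) geB geC = sym (conn-unique-suc r′ ε geC geB)

    conn-unique : ∀ T → T ≤ suc ℓ → ConnUnique T
    conn-unique zero    _        ε ε _ _ = refl
    conn-unique zero    _        (matched _ (_ , _ , _ , _ , _ , ()) ◅ _) _ _ _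
    conn-unique zero    _        ε (matched _ (_ , _ , _ , _ , _ , ()) ◅ _) _ _
    conn-unique (suc t) (s≤s t≤) = Step.conn-unique-suc t t≤ (conn-unique t (m≤n⇒m≤1+n t≤))

  -- Translation to and from paths given as functions on `Fin`.

  -- Indices past the end return the last vertex.
  at : Path k v → ℕ → Fin n
  at (start {f} _)              i = f
  at (step {k} {v = v} P _ _ _) i with i ≤? k
  ... | yes _ = at P i
  ... | no  _ = v

  at-end : (P : Path k v) → at P k ≡ v
  at-end (start _) = refl
  at-end (step {k} P _ _ _) with suc k ≤? k
  ... | yes p = ⊥-elim (1+n≰n p)
  ... | no  _ = refl

  at-∈ : (P : Path k v) → ∀ i → at P i ∈ P
  at-∈ (start _)          i = refl
  at-∈ (step {k} P _ _ _) i with i ≤? k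
  ... | yes _ = inj₂ (at-∈ P i)
  ... | no  _ = inj₁ refl

  at-zero : (P : Path k v) → Unmatched E M (at P 0)
  at-zero (start f)      = f
  at-zero (step P _ _ _) = at-zero P

  at-injective : (P : Path k v) → i ≤ k → j ≤ k → at P i ≡ at P j → i ≡ j
  at-injective (start _) z≤n z≤n _ = refl
  at-injective {i = i} {j} (step {k} P _ _ s) i≤ j≤ eq with i ≤? k | j ≤? k
  ... | yes p | yes q = at-injective P p q eq
  ... | yes p | no  q = ⊥-elim (s (subst (_∈ P) eq (at-∈ P i)))
  ... | no  p | yes q = ⊥-elim (s (subst (_∈ P) (sym eq) (at-∈ P j)))
  ... | no  p | no  q = trans (≤-antisym i≤ (≰⇒> p)) (≤-antisym (≰⇒> q) j≤)

  at-edge : (P : Path k v) → i < k →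
            E (at P i) (at P (suc i)) ≡ true × M (at P i) (at P (suc i)) ≡ oddᵇ i
  at-edge {i = i} (step {k} P e m _) i<k with i ≤? k | suc i ≤? k
  ... | no  p | _     = ⊥-elim (p (s≤s⁻¹ i<k))
  ... | yes p | yes q = at-edge P q
  ... | yes p | no  q with ≤-antisym p (≮⇒≥ q)
  ...   | refl rewrite at-end P = e , m

  at-prefix : {Q : Path j w} {P : Path k v} → Q ⊑ P → at P j ≡ w
  at-prefix {Q = Q} here = at-end Q
  at-prefix {j = j} (there {k = k} S) with j ≤? k
  ... | yes _ = at-prefix S
  ... | no  p = ⊥-elim (p (⊑-length S))

  at-After : {Q : Path j w} {P : Path k v} (S : Q ⊑ P) → j < i → i ≤ k → After S (at P i)
  at-After here j<i i≤k = ⊥-elim (<⇒≱ j<i i≤k)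
  at-After {i = i} (there {k = k} S) j<i i≤k with i ≤? k
  ... | yes p = inj₂ (at-After S j<i p)
  ... | no  _ = inj₁ refl

  to-AltPath : (P : Path k v) → AltPath E M k (at P ∘ toℕ)
  to-AltPath P = record
    { start-unmatched = at-zero P
    ; simple          = λ {i} {j} eq → Fin.toℕ-injective
                          (at-injective P (Fin.toℕ≤pred[n] i) (Fin.toℕ≤pred[n] j) eq)
    ; edge            = λ i → proj₁ (at-edge′ i)
    ; alternates      = λ i → proj₂ (at-edge′ i)
    }
    where
      at-edge′ : ∀ i → E (at P (toℕ (inject₁ i))) (at P (suc (toℕ i))) ≡ true ×
                       M (at P (toℕ (inject₁ i))) (at P (suc (toℕ i))) ≡ oddᵇ (toℕ i)
      at-edge′ i rewrite Fin.toℕ-inject₁ i = at-edge P (Fin.toℕ<n i)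

  at-fromℕ : (P : Path k v) → at P (toℕ (fromℕ k)) ≡ v
  at-fromℕ {k} P rewrite Fin.toℕ-fromℕ k = at-end P

  to-AltPathTo : Path k v → AltPathTo E M v k
  to-AltPathTo P = at P ∘ toℕ , to-AltPath P , at-fromℕ P

  -- The covering clause gives freshness in the induction; the prefix clause turns positions on `p`
  -- into prefixes, as `IsBase` requires.
  from-AltPath : ∀ {k} (p : Fin (suc k) → Fin n) → AltPath E M k p →
                 Σ (Path k (p (fromℕ k))) λ P →
                 (∀ {y} → y ∈ P → ∃[ j ] p j ≡ y) ×
                 (∀ i → ∃[ l ] Σ (Path l (p i)) λ B → Σ (B ⊑ P) λ S →
                        ∀ {y} → After S y → ∃[ j ] toℕ i < toℕ j × p j ≡ y)
  from-AltPath {zero} p alt =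
    P , (λ { refl → zero , refl }) , λ { zero → 0 , P , here , λ () }
    where P = start (AltPath.start-unmatched alt)
  from-AltPath {suc k} p alt with from-AltPath (p ∘ inject₁) record
    { start-unmatched = AltPath.start-unmatched alt
    ; simple          = Fin.inject₁-injective ∘ AltPath.simple alt
    ; edge            = AltPath.edge alt ∘ inject₁
    ; alternates      = λ i → trans (AltPath.alternates alt (inject₁ i)) (cong oddᵇ (Fin.toℕ-inject₁ i))
    }
  ... | P , covered , prefix = R , covered′ , prefix′
    where
      R : Path (suc k) (p (fromℕ (suc k)))
      R = step P (AltPath.edge alt (fromℕ k))
                 (trans (AltPath.alternates alt (fromℕ k)) (cong oddᵇ (Fin.toℕ-fromℕ k)))
                 (λ q → Fin.fromℕ≢inject₁ (sym (AltPath.simple alt (proj₂ (covered q)))))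
      covered′ : ∀ {y} → y ∈ R → ∃[ j ] p j ≡ y
      covered′ (inj₁ refl) = fromℕ (suc k) , refl
      covered′ (inj₂ q)    = inject₁ (proj₁ (covered q)) , proj₂ (covered q)
      prefix′ : ∀ i → ∃[ l ] Σ (Path l (p i)) λ B → Σ (B ⊑ R) λ S →
                      ∀ {y} → After S y → ∃[ j ] toℕ i < toℕ j × p j ≡ y
      prefix′ i with view i
      ... | ‵fromℕ      = _ , R , here , λ ()
      ... | ‵inject₁ i′ with prefix i′
      ...   | l , B , S , after = l , B , there S ,
        λ { (inj₁ refl) → fromℕ (suc k) , 
              subst₂ _<_ (sym (Fin.toℕ-inject₁ i′)) (sym (Fin.toℕ-fromℕ (suc k))) (Fin.toℕ<n i′) ,
              refl
          ; (inj₂ q) → let j , lt , eq = after q in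
              inject₁ j , subst₂ _<_ (sym (Fin.toℕ-inject₁ i′)) (sym (Fin.toℕ-inject₁ j)) lt , eq }

  from-AltPathTo : AltPathTo E M v k → Path k v
  from-AltPathTo (p , alt , refl) = proj₁ (from-AltPath p alt)

  to-even-level : Path k v → Lev k v → Even k → IsEvenLevel E M v k
  to-even-level P lev ev =
    ev , to-AltPathTo P , λ k′ ev′ p → lev (from-AltPathTo p) (trans ev′ (sym ev))

  to-odd-level : Path k v → Lev k v → Odd k → IsOddLevel E M v k
  to-odd-level P lev od =
    od , to-AltPathTo P , λ k′ od′ p → lev (from-AltPathTo p) (trans od′ (sym od))

  even-level⇒Lev : IsEvenLevel E M v k → Lev k v
  even-level⇒Lev (ev , _ , min) P par = min _ (trans par ev) (to-AltPathTo P)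

  odd-level⇒Lev : IsOddLevel E M v k → Lev k v
  odd-level⇒Lev (od , _ , min) P par = min _ (trans par od) (to-AltPathTo P)

  TenacityGt⇒Ge : TenacityGt E M v t → Ge (suc t) v
  TenacityGt⇒Ge gt {a} {b} P Q par with shortest P | shortest Q
  ... | a′ , P′ , parP , a′≤a , levP | b′ , Q′ , parQ , b′≤b , levQ with even-or-odd b
  ...   | inj₂ od = <-≤-trans (gt a′ b′ (to-even-level P′ levP (trans parP (trans par (cong not od))))
                                        (to-odd-level Q′ levQ (trans parQ od)))
                              (+-mono-≤ a′≤a b′≤b)
  ...   | inj₁ ev = <-≤-trans (gt b′ a′ (to-even-level Q′ levQ (trans parQ ev))
                                        (to-odd-level P′ levP (trans parP (trans par (cong not ev)))))
                              (≤-trans (+-mono-≤ b′≤b a′≤a) (≤-reflexive (+-comm b a)))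

  Ge⇒TenacityGt : Ge (suc t) v → TenacityGt E M v t
  Ge⇒TenacityGt ge a b (ev , p , _) (od , q , _) =
    ge (from-AltPathTo p) (from-AltPathTo q) (trans ev (cong not (sym od)))

  augmenting-length : BelowLm E M t → Unmatched E M v → Path k v → Odd k → t < k
  augmenting-length {k = suc k} below f P _ =
    below (suc k) _ (to-AltPath P) (subst (Unmatched E M) (sym (at-fromℕ P)) f)
      λ eq → 0≢1+n (at-injective P z≤n ≤-refl (trans eq (cong (at P) (Fin.toℕ-fromℕ (suc k)))))

  -- Of two paths of opposite parity to an unmatched vertex, the odd one is augmenting.
  start-ge : BelowLm E M t → Unmatched E M v → Ge (suc t) v
  start-ge below f {a} {b} P Q par with even-or-odd b
  ... | inj₂ od = ≤-trans (augmenting-length below f Q od) (m≤n+m b a)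
  ... | inj₁ ev = ≤-trans (augmenting-length below f P (trans par (cong not ev))) (m≤m+n a b)

  -- Existence and uniqueness of bases.

  module _ (below : BelowLm E M t) where
    open Bounded t (start-ge below)

    -- Forgets the path: what remains is a connection to a vertex of large tenacity, which
    -- `conn-unique` determines.
    IsBase⇒Conn : IsBase E M v t b → Conn (suc t) v b × Ge (suc t) b
    IsBase⇒Conn (k , p , alt , refl , level , i , refl , gt , last) with from-AltPath p alt
    ... | P , _ , prefix with prefix i
    ...   | l , B , S , after = last-ge-connected lev (last-ge B S geB low′) , geB
      where
        lev : Lev k _
        lev = [ even-level⇒Lev , odd-level⇒Lev ]′ level
        geB : Ge (suc t) (p i)
        geB = TenacityGt⇒Ge gt
        low′ : ∀ {y} → After S y → Low (suc t) y
        low′ {y} q with Low? (suc t) y | after q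
        ... | yes low | _ = low
        ... | no ¬low | j , lt , refl = ⊥-elim (last j lt (Ge⇒TenacityGt (¬Low⇒Ge ¬low)))

    base-unique : IsBase E M v t b → IsBase E M v t c → b ≡ c
    base-unique p q with IsBase⇒Conn p | IsBase⇒Conn q
    ... | r , geB | r′ , geC = conn-unique (suc t) ≤-refl r r′ geB geC

    base-exists : TenacityEq E M v t → ∃[ b ] IsBase E M v t b
    base-exists (k , _ , level@(_ , q , _) , _ , _) with from-AltPathTo q
    ... | P with find-last-ge ≤-refl P
    ...   | last-ge {b} {l} B S geB low =
      b , k , at P ∘ toℕ , to-AltPath P , at-fromℕ P , inj₁ level ,
      fromℕ< l<1+k , trans (cong (at P) (Fin.toℕ-fromℕ< l<1+k)) (at-prefix S) , Ge⇒TenacityGt geB ,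
      λ j lt gt → Low-Ge (low (at-After S (subst (_< toℕ j) (Fin.toℕ-fromℕ< l<1+k) lt) (Fin.toℕ≤pred[n] j)))
                         (TenacityGt⇒Ge gt)
      where l<1+k = s≤s (⊑-length S)

  -- Deciding membership in a blossom.

  TenacityEq-unique : ∀ {s} → TenacityEq E M v s → TenacityEq E M v t → s ≡ t
  TenacityEq-unique (a , b , (ev , p , min) , (od , q , min′) , refl)
                    (c , d , (ev₁ , p₁ , min₁) , (od₁ , q₁ , min₁′) , refl) =
    cong₂ _+_ (≤-antisym (min c ev₁ p₁) (min₁ a ev p)) (≤-antisym (min′ d od₁ q₁) (min₁′ b od q))

  level? : ∀ k v → Dec (Path k v × Lev k v)
  level? k v with path? k v
  ... | no ¬P = no (¬P ∘ proj₁)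
  ... | yes P with shortest P
  ...   | l , Q , par , l≤k , lev with l ≟ k
  ...     | yes refl = yes (P , lev)
  ...     | no  l≢k  = no λ (_ , lev′) → l≢k (≤-antisym l≤k (lev′ Q par))

  even-level? : ∀ v k → Dec (IsEvenLevel E M v k)
  even-level? v k = map′ to from ((oddᵇ k Bool.≟ false) ×-dec level? k v)
    where
      to : Even k × Path k v × Lev k v → IsEvenLevel E M v k
      to (ev , P , lev) = to-even-level P lev ev
      from : IsEvenLevel E M v k → Even k × Path k v × Lev k v
      from p@(ev , q , _) = ev , from-AltPathTo q , even-level⇒Lev p

  odd-level? : ∀ v k → Dec (IsOddLevel E M v k)
  odd-level? v k = map′ to from ((oddᵇ k Bool.≟ true) ×-dec level? k v)
    where
      to : Odd k × Path k v × Lev k v → IsOddLevel E M v k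
      to (od , P , lev) = to-odd-level P lev od
      from : IsOddLevel E M v k → Odd k × Path k v × Lev k v
      from p@(od , q , _) = od , from-AltPathTo q , odd-level⇒Lev p

  TenacityEq? : ∀ v t → Dec (TenacityEq E M v t)
  TenacityEq? v t =
    map′ (λ (a , _ , b , _ , r) → a , b , r)
         (λ { (a , b , r@(_ , _ , refl)) → a , s≤s (m≤m+n a b) , b , s≤s (m≤n+m b a) , r })
         (anyUpTo? (λ a → anyUpTo? (λ b →
            even-level? v a ×-dec odd-level? v b ×-dec (a + b ≟ t)) (suc t)) (suc t))

  Outer? : TenacityEq E M v t → Dec (Outer E M v)
  Outer? (a , b , lev@(ev , p , min) , lev′@(od , q , min′) , _) with a <? b
  ... | yes a<b = yes (a , lev , λ b′ (od₁ , q₁ , _) → <-≤-trans a<b (min′ b′ od₁ q₁))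
  ... | no  a≮b = no λ (a′ , (ev₁ , p₁ , _) , f) → a≮b (≤-<-trans (min a′ ev₁ p₁) (f b lev′))

  -- No search over the paths in `IsBase`: by uniqueness it suffices to compare `b` with one base.
  InS? : BelowLm E M t → ∀ b v → Dec (InS E M b t v)
  InS? {t} below b v with TenacityEq? v t
  ... | no ¬ten = no (¬ten ∘ proj₁)
  ... | yes ten with base-exists below ten
  ...   | c , base with b Fin.≟ c
  ...     | yes refl = yes (ten , base)
  ...     | no  b≢c  = no λ (_ , base′) → b≢c (base-unique below base′ base)

  BelowLm-mono : ∀ {s} → s ≤ t → BelowLm E M t → BelowLm E M s
  BelowLm-mono s≤t below k p alt f ne = ≤-<-trans s≤t (below k p alt f ne)

  -- Lets a common vertex of two blossoms be searched for, so that the final alternative is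
  -- constructive.
  InBlossom? : BelowLm E M t → Outer E M b → ∀ w → Dec (InBlossom E M b t w)
  InBlossom? {0} _ _ w = no λ ()
  InBlossom? {1} _ _ w = no λ ()
  InBlossom? {2} _ _ w = no λ ()
  InBlossom? {suc (suc (suc s))} {b} below outer w =
    map′ to from (InS? below b w ⊎-dec InBlossom? {suc s} below′ outer w ⊎-dec 
                  Fin.any? (via? λ o → InBlossom? {suc s} below′ o w))
    where
      below′ : BelowLm E M (1 + s)
      below′ = BelowLm-mono (m≤n+m (1 + s) 2) below
      Via : Fin n → Set
      Via v = InS E M b (3 + s) v × Outer E M v × InBlossom E M v (1 + s) w
      via? : (∀ {v} → Outer E M v → Dec (InBlossom E M v (1 + s) w)) → ∀ v → Dec (Via v)
      via? rec v with InS? below b v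
      ... | no ¬p = no (¬p ∘ proj₁)
      ... | yes p with Outer? (proj₁ p)
      ...   | no ¬o = no (¬o ∘ proj₁ ∘ proj₂)
      ...   | yes o = map′ (λ q → p , o , q) (proj₂ ∘ proj₂) (rec o)
      Cases : Set
      Cases = InS E M b (3 + s) w ⊎ InBlossom E M b (1 + s) w ⊎ ∃ Via
      to : Cases → InBlossom E M b (3 + s) w
      to (inj₁ p)                      = inS p
      to (inj₂ (inj₁ q))               = viaB outer q
      to (inj₂ (inj₂ (_ , p , o , q))) = viaS p o q
      from : InBlossom E M b (3 + s) w → Cases
      from (inS p)      = inj₁ p
      from (viaS p o q) = inj₂ (inj₂ (_ , p , o , q))
      from (viaB _ q)   = inj₂ (inj₁ q)

  -- Containment between blossoms.

  -- Iterating bases stays inside the blossom until it reaches `b`: an inner chain ends at some `v`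
  -- in `S` of the outer blossom, or at `b`.
  InBlossom-base : InBlossom E M b t w →
    ∃[ s ] ∃[ c ] InS E M c s w × s ≤ t × (c ≡ b ⊎ Outer E M c × InBlossom E M b t c)
  InBlossom-base (inS p) = _ , _ , p , ≤-refl , inj₁ refl
  InBlossom-base (viaS p o q) with InBlossom-base q
  ... | s , c , r , s≤ , inj₁ refl       = s , c , r , ≤-trans s≤ (m≤n+m _ 2) , inj₂ (o , inS p)
  ... | s , c , r , s≤ , inj₂ (oc , q′) = s , c , r , ≤-trans s≤ (m≤n+m _ 2) , inj₂ (oc , viaS p o q′)
  InBlossom-base (viaB o q) with InBlossom-base q
  ... | s , c , r , s≤ , inj₁ refl       = s , c , r , ≤-trans s≤ (m≤n+m _ 2) , inj₁ refl
  ... | s , c , r , s≤ , inj₂ (oc , q′) = s , c , r , ≤-trans s≤ (m≤n+m _ 2) , inj₂ (oc , viaB o q′)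

  InBlossom-tenacity : InBlossom E M b t w → ∃[ s ] TenacityEq E M w s × s ≤ t
  InBlossom-tenacity p with InBlossom-base p
  ... | s , _ , (ten , _) , s≤t , _ = s , ten , s≤t

  TenacityGt-< : ∀ {s} → TenacityGt E M v t → TenacityEq E M v s → t < s
  TenacityGt-< gt (a , b , lev , lev′ , refl) = gt a b lev lev′

  InBlossom-mono : ∀ {s} → Outer E M b → Odd s → Odd t → s ≤ t →
                   InBlossom E M b s w → InBlossom E M b t w
  InBlossom-mono {t = t} {s = s} outer os ot s≤t p with m≤n⇒m<n∨m≡n s≤t
  ... | inj₂ refl = p
  InBlossom-mono {t = suc zero} outer os ot s≤t () | inj₁ (s≤s z≤n)
  InBlossom-mono {t = suc (suc zero)} outer os () s≤t p | inj₁ s<t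
  InBlossom-mono {t = suc (suc (suc t))} outer os ot s≤t p | inj₁ s<t =
    viaB outer (InBlossom-mono {t = suc t} outer os (not-not-elim ot) (odd-< os ot s<t) p)

  -- Follows the derivation of `c` down to the level where `c` lies in `S`. There its tenacity
  -- exceeds `s`, so by parity the blossom of `c` at `s` fits two below that level.
  InBlossom-absorb : ∀ {s} → Outer E M c → TenacityGt E M c s → Odd s → Odd t →
                     InBlossom E M b t c → InBlossom E M c s w → InBlossom E M b t w
  InBlossom-absorb o gt os ot (inS p) q =
    viaS p o (InBlossom-mono o os (not-not-elim ot) (odd-< os ot (TenacityGt-< gt (proj₁ p))) q)
  InBlossom-absorb o gt os ot (viaS p o′ r) q =
    viaS p o′ (InBlossom-absorb o gt os (not-not-elim ot) r q)
  InBlossom-absorb o gt os ot (viaB o′ r) q =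
    viaB o′ (InBlossom-absorb o gt os (not-not-elim ot) r q)

  -- Two chains of iterated bases starting at the same vertex coincide as far as
  -- the shorter one reaches; the tenacity increases along a chain.
  InBlossom-nested : ∀ N {s} → TenacityEq E M w s → t ≤ N + s → BelowLm E M t →
                     t ≤ T → TenacityGt E M c T → InBlossom E M b t w → InBlossom E M c T w →
                     b ≡ c ⊎ InBlossom E M c T b
  InBlossom-nested N ten t≤ below t≤T gt p q with InBlossom-base p | InBlossom-base q
  ... | s₁ , b₁ , (ten₁ , base₁) , s₁≤t , r₁ | s₂ , b₂ , (ten₂ , base₂) , s₂≤T , r₂
    with TenacityEq-unique ten₁ ten₂ | TenacityEq-unique ten ten₁
  ... | refl | refl with base-unique (BelowLm-mono s₁≤t below) base₁ base₂
  ... | refl with r₁ | r₂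
  ... | inj₁ refl | inj₁ refl      = inj₁ refl
  ... | inj₁ refl | inj₂ (_ , q′) = inj₂ q′
  -- Here `c` would lie in the blossom of `b`, hence have tenacity at most `t ≤ T`.
  ... | inj₂ (_ , p′) | inj₁ refl =
    let s′ , ten′ , s′≤t = InBlossom-tenacity p′ in
    ⊥-elim (<⇒≱ (TenacityGt-< gt ten′) (≤-trans s′≤t t≤T))
  ... | inj₂ (_ , p′) | inj₂ (_ , q′) with InBlossom-tenacity p′ | base₁ | N
  ... | s′ , ten′ , s′≤t | _ , _ , _ , _ , _ , _ , _ , gt₁ , _ | zero =
    ⊥-elim (<⇒≱ (TenacityGt-< gt₁ ten′) (≤-trans s′≤t t≤))
  ... | s′ , ten′ , s′≤t | _ , _ , _ , _ , _ , _ , _ , gt₁ , _ | suc N′ =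
    InBlossom-nested N′ ten′
      -- The base has tenacity above `s₁`, which pays for the unit of fuel spent.
      (≤-trans t≤ (≤-trans (≤-reflexive (sym (+-suc N′ s₁))) (+-monoʳ-≤ N′ (TenacityGt-< gt₁ ten′))))
      below t≤T gt p′ q′

  -- A common vertex puts `b` at `c` or inside the larger blossom; monotonicity in `t` or absorption
  -- then gives the inclusion.
  InBlossom-⊆ : IsBlossom E M b t → IsBlossom E M c T → t ≤ T →
                InBlossom E M b t w → InBlossom E M c T w →
                ∀ y → InBlossom E M b t y → InBlossom E M c T y
  InBlossom-⊆ {t = t} (ob , odt , gtb , below) (oc , odT , gtc , _) t≤T p q y r
    with InBlossom-tenacity p
  ... | s , ten , _ with InBlossom-nested t ten (m≤m+n t s) below t≤T gtc p q
  ...   | inj₁ refl = InBlossom-mono ob odt odT t≤T r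
  ...   | inj₂ q′   = InBlossom-absorb ob gtb odt odT q′ r

  laminar : ∀ b t b′ t′ → IsBlossom E M b t → IsBlossom E M b′ t′ →
            (∀ w → InBlossom E M b t w → ¬ InBlossom E M b′ t′ w)
            ⊎ ((∀ w → InBlossom E M b t w → InBlossom E M b′ t′ w)
               ⊎ (∀ w → InBlossom E M b′ t′ w → InBlossom E M b t w))
  laminar b t b′ t′ B@(o , _ , _ , below) B′@(o′ , _ , _ , below′)
    with Fin.any? (λ w → InBlossom? below o w ×-dec InBlossom? below′ o′ w)
  ... | no none = inj₁ λ w p q → none (w , p , q)
  ... | yes (w , p , q) with ≤-total t t′
  ...   | inj₁ t≤t′ = inj₂ (inj₁ (InBlossom-⊆ B B′ t≤t′ p q))
  ...   | inj₂ t′≤t = inj₂ (inj₂ (InBlossom-⊆ B′ B t′≤t q p))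

theorem3 : ∀ {n : ℕ} (E M : Fin n → Fin n → Bool) → IsGraph E → IsMatching E M →
    (∃[ u ] Unmatched E M u) →
    ∀ b t b′ t′ → IsBlossom E M b t → IsBlossom E M b′ t′ →
    (∀ w → InBlossom E M b t w → ¬ InBlossom E M b′ t′ w)
    ⊎ ((∀ w → InBlossom E M b t w → InBlossom E M b′ t′ w)
    ⊎ (∀ w → InBlossom E M b′ t′ w → InBlossom E M b t w))
theorem3 E M graph matching _ = Alternating.laminar graph matching
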